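{- Let $q$ be a prime power, $m$ a positive integer and $k\ge3$ an integer. A nondegenerate $[(k-1)m,k]_{q^m/q}$ minimal code exists if and only if $m\ge3$.
   Context: For $v\in\mathbb{F}_{q^m}^n$ and an ordered basis $\Gamma=(\gamma_1,\dots,\gamma_m)$ of $\mathbb{F}_{q^m}$ over $\mathbb{F}_q$, let $\Gamma(v)\in\mathbb{F}_q^{n\times m}$ be the matrix with $v_i=\sum_{j}\Gamma(v)_{ij}\gamma_j$. The rank support $\sigma^{\mathrm{rk}}(v)\subseteq\mathbb{F}_q^n$ is the column space of $\Gamma(v)$ (independent of $\Gamma$). An $[n,k]_{q^m/q}$ code is a $k$-dimensional $\mathbb{F}_{q^m}$-subspace $\mathcal{C}\subseteq\mathbb{F}_{q^m}^n$; it is nondegenerate if $\sum_{v\in\mathcal{C}}\sigma^{\mathrm{rk}}(v)=\mathbb{F}_q^n$, and minimal if for all $v,v'\in\mathcal{C}$, $\sigma^{\mathrm{rk}}(v')\subseteq\sigma^{\mathrm{rk}}(v)$ implies $v'=\alpha v$ for some $\alpha\in\mathbb{F}_{q^m}$. -}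

module Defs where

open import Level using (0ℓ)
open import Algebra.Bundles using (CommutativeRing)
open import Algebra.Definitions using (Invertible)
open import Algebra.Morphism.Structures using (IsRingHomomorphism)
open import Algebra.Structures using (IsCommutativeRing)
import Algebra.Properties.CommutativeMonoid.Sum as Sum
open import Data.Fin.Base using (Fin)
open import Data.Nat.Base using (ℕ; _≤_; _^_)
open import Data.Nat.Primality using (Prime)
open import Data.Product.Base using (_×_; ∃; ∃-syntax; proj₁)
open import Data.Vec.Functional using (Vector; transpose)
open import Function.Bundles using (_↔_)
open import Relation.Binary.PropositionalEquality using (_≡_; _≢_; _≗_)
open import Relation.Unary using (Pred; _∈_; _⊆_)

IsPrimePower : ℕ → Set
IsPrimePower q = ∃[ p ] ∃[ e ] Prime p × 1 ≤ e × q ≡ p ^ e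

record Field : Set₁ where
  infix  8 -_
  infixl 7 _*_
  infixl 6 _+_
  field
    Carrier           : Set
    _+_ _*_           : Carrier → Carrier → Carrier
    -_                : Carrier → Carrier
    0# 1#             : Carrier
    isCommutativeRing : IsCommutativeRing _≡_ _+_ _*_ -_ 0# 1#
    0≢1               : 0# ≢ 1#
    invertible        : ∀ x → x ≢ 0# → Invertible _≡_ 1# _*_ x

  commutativeRing : CommutativeRing 0ℓ 0ℓ
  commutativeRing = record { isCommutativeRing = isCommutativeRing }

  open CommutativeRing commutativeRing public
    using (rawRing; +-commutativeMonoid)
  open Sum +-commutativeMonoid public using (sum; sum-syntax)

HasOrder : Field → ℕ → Set
HasOrder F q = Field.Carrier F ↔ Fin q

-- Vectors are functions on Fin n, so equality of vectors is pointwise (_≗_),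
-- and a subset of the coordinate space has to respect it to be a subspace.
module CoordinateSpace (F : Field) where
  open Field F

  Space : ℕ → Set
  Space n = Vector Carrier n

  linearCombination : ∀ {s n} → Vector Carrier s → Vector (Space n) s → Space n
  linearCombination {s} c b i = ∑[ j < s ] (c j * b j i)

  record IsSubspace {n} (C : Pred (Space n) 0ℓ) : Set where
    field
      respects : ∀ {u v} → u ≗ v → u ∈ C → v ∈ C
      0-closed : (λ _ → 0#) ∈ C
      +-closed : ∀ {u v} → u ∈ C → v ∈ C → (λ i → u i + v i) ∈ C
      *-closed : ∀ a {v} → v ∈ C → (λ i → a * v i) ∈ C

  record IsBasis {k n} (C : Pred (Space n) 0ℓ) (b : Vector (Space n) k) : Set where
    field
      members     : ∀ j → b j ∈ C
      independent : ∀ c → linearCombination c b ≗ (λ _ → 0#) → ∀ j → c j ≡ 0#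
      spanning    : ∀ {v} → v ∈ C → ∃[ c ] v ≗ linearCombination c b

  HasDimension : ∀ {n} → Pred (Space n) 0ℓ → ℕ → Set
  HasDimension {n} C k = ∃[ b ] IsBasis {k} {n} C b

  -- A matrix is given by its rows.
  ColumnSpace : ∀ {n m} → Vector (Vector Carrier m) n → Pred (Space n) 0ℓ
  ColumnSpace M w = ∃[ c ] w ≗ linearCombination c (transpose M)

  -- The sum of the family (S x) over all x ∈ P, i.e. the set of finite sums
  -- of vectors each taken from some member of the family.
  SumOver : ∀ {X : Set} {n} → Pred X 0ℓ → (X → Pred (Space n) 0ℓ) → Pred (Space n) 0ℓ
  SumOver {X} {n} P S w =
    ∃[ s ] ∃ λ (x : Vector X s) → ∃ λ (u : Vector (Space n) s) →
      (∀ t → x t ∈ P) × (∀ t → u t ∈ S (x t)) × (∀ i → w i ≡ ∑[ t < s ] u t i)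

record Extension (F K : Field) : Set where
  field
    embed          : Field.Carrier F → Field.Carrier K
    isHomomorphism : IsRingHomomorphism (Field.rawRing F) (Field.rawRing K) embed

record OrderedBasis {F K : Field} (E : Extension F K) (m : ℕ) : Set where
  private module F = Field F
  open Field K
  open Extension E

  field
    γ : Vector Carrier m

  combine : Vector F.Carrier m → Carrier
  combine a = ∑[ j < m ] (embed (a j) * γ j)

  field
    independent : ∀ a → combine a ≡ 0# → ∀ j → a j ≡ F.0#
    spanning    : ∀ x → ∃[ a ] x ≡ combine a

  expand : ∀ {n} → Vector Carrier n → Vector (Vector F.Carrier m) n
  expand v i = proj₁ (spanning (v i))

module RankMetric {F K : Field} {E : Extension F K} {m : ℕ} (Γ : OrderedBasis E m) where
  private
    module F where
      open Field F public
      open CoordinateSpace F public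
    module K where
      open Field K public
      open CoordinateSpace K public
  open OrderedBasis Γ using (expand)

  rankSupport : ∀ {n} → K.Space n → Pred (F.Space n) 0ℓ
  rankSupport v = F.ColumnSpace (expand v)

  record Code (n k : ℕ) : Set₁ where
    field
      codewords  : Pred (K.Space n) 0ℓ
      isSubspace : K.IsSubspace codewords
      dimension  : K.HasDimension codewords k

  open Code

  Nondegenerate : ∀ {n k} → Code n k → Set
  Nondegenerate C = ∀ w → w ∈ F.SumOver (codewords C) rankSupport

  Minimal : ∀ {n k} → Code n k → Set
  Minimal C = ∀ {v v′} → v ∈ codewords C → v′ ∈ codewords C →
    rankSupport v′ ⊆ rankSupport v → ∃[ α ] v′ ≗ (λ i → α K.* v i)

{-# OPTIONS --safe #-}
module Submission where

-- Everything is finite, so the pigeonhole principle supplies the linear algebra: an additive map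
-- A^m → B^n with |B|^n < |A|^m kills a nonzero vector.
--
-- For m = 1 the length is smaller than the dimension. For m = 2, counting yields codewords
-- v = γ₀ w and v′ = γ₁ w′ with w, w′ over F and an index i with wᵢ ≠ 0 = w′ᵢ; the support of v lies
-- in that of v + v′, although v is not a multiple of v + v′.
--
-- For m ≥ 3, let the columns of the generator matrix be the γ_l e_j for all pairs (j , l) but m, the
-- omitted pairs occupying three different rows j; let U be their F-span, of F-dimension (k-1)m in K^k.
-- An inclusion of supports between the codewords of y and y′ says that y · u = 0 implies y′ · u = 0
-- on U. If y and y′ were independent, then U + F z would be too large for this, where z ∉ U is
-- orthogonal to both: by counting, it contains a nonzero multiple of an s with y · s = 0 ≠ y′ · s.

open import Defs
open import Level using (0ℓ)
open import Algebra.Bundles using (CommutativeRing)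
open import Algebra.Morphism.Structures using (IsRingHomomorphism)
import Algebra.Properties.CommutativeSemigroup as CommutativeSemigroupProperties
import Algebra.Properties.Ring as RingProperties
import Algebra.Properties.Semiring.Sum as SemiringSum
open import Data.Fin.Base as Fin
  using (Fin; zero; suc; punchIn; punchOut; finToFun; funToFin; remQuot; _↑ˡ_; splitAt)
open import Data.Fin.Properties
  using (_≟_; all?; pigeonhole; ¬∀⟶∃¬; punchInᵢ≢i; punchIn-punchOut; funToFin-finToFin; finToFun-funToFin;
         combine-remQuot; remQuot-combine; <⇒≢)
open import Data.Fin.Patterns using (0F; 1F; 2F)
open import Data.Nat.Base as ℕ using (ℕ; zero; suc; _≤_; _<_; _∸_; _^_; z≤n; s≤s)
import Data.Nat.Properties as ℕₚ
open import Data.Product.Base using (_×_; ∃; ∃-syntax; _,_; proj₁; proj₂; uncurry)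
open import Data.Vec.Functional using (Vector; removeAt; _∷_; []; _++_)
open import Data.Sum.Base using (inj₁; inj₂)
open import Data.Vec.Functional.Properties using (lookup-++ˡ)
open import Function.Base using (_∘_)
open import Function.Bundles using (_⇔_; mk⇔; Inverse; Injection)
open import Function.Properties.Inverse using (↔⇒↣; ↔-sym)
open import Relation.Binary.Definitions using (DecidableEquality)
open import Relation.Binary.PropositionalEquality
  using (_≡_; _≢_; _≗_; refl; sym; trans; cong; cong₂; subst; module ≡-Reasoning)
open import Relation.Nullary using (¬_; Dec; yes; no; contradiction)
open import Relation.Nullary.Decidable using (via-injection; decidable-stable)
open import Relation.Unary using (Pred; _∈_; _⊆_)

open CoordinateSpace using (Space; IsSubspace; IsBasis)

-- Finite sums and cancellation in a field.

module FieldProperties (F : Field) where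
  open Field F
  open CommutativeRing commutativeRing public
    using (+-assoc; +-identityˡ; +-identityʳ; -‿inverseˡ;
           *-assoc; *-comm; *-identityˡ; *-identityʳ; zeroˡ; zeroʳ; distribˡ; distribʳ; ring; semiring;
           *-commutativeSemigroup; +-commutativeSemigroup)
  open RingProperties ring public
    using (x∙y⁻¹≈ε⇒x≈y; x≈y⇒x∙y⁻¹≈ε; -‿distribˡ-*; +-identityˡ-unique; +-identityʳ-unique)
  open CommutativeSemigroupProperties *-commutativeSemigroup public using (x∙yz≈y∙xz)
  open CommutativeSemigroupProperties +-commutativeSemigroup public using (interchange)
  open SemiringSum semiring public
    using (sum-cong-≗; sum-remove; sum-replicate-zero; ∑-distrib-+; ∑-comm; *-distribˡ-sum)
  open ≡-Reasoning

  sum-zero : ∀ {n} {f : Vector Carrier n} → (∀ i → f i ≡ 0#) → sum f ≡ 0#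
  sum-zero {n} f≡0 = trans (sum-cong-≗ f≡0) (sum-replicate-zero n)

  sum-single : ∀ {n} (i : Fin n) {f : Vector Carrier n} →
    (∀ j → j ≢ i → f j ≡ 0#) → sum f ≡ f i
  sum-single {suc n} i {f} f≡0 = begin
    sum f                     ≡⟨ sum-remove {i = i} f ⟩
    f i + sum (removeAt f i)  ≡⟨ cong (f i +_) (sum-zero λ j → f≡0 (punchIn i j) (punchInᵢ≢i i j)) ⟩
    f i + 0#                  ≡⟨ +-identityʳ (f i) ⟩
    f i                       ∎

  -- Both sides expand to the bilinear form of the matrix `M` at `a` and `c`. It lets a relation
  -- that holds on the columns of a matrix pass to every combination of them.
  ∑-*-comm : ∀ {m n} (a : Vector Carrier m) (c : Vector Carrier n) (M : Fin m → Fin n → Carrier) →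
    ∑[ i < m ] (a i * ∑[ j < n ] (c j * M i j)) ≡ ∑[ j < n ] (c j * ∑[ i < m ] (a i * M i j))
  ∑-*-comm {m} {n} a c M = begin
    ∑[ i < m ] (a i * ∑[ j < n ] (c j * M i j))
      ≡⟨ sum-cong-≗ (λ i → *-distribˡ-sum (a i) (λ j → c j * M i j)) ⟩
    ∑[ i < m ] (∑[ j < n ] (a i * (c j * M i j)))
      ≡⟨ ∑-comm (λ i j → a i * (c j * M i j)) ⟩
    ∑[ j < n ] (∑[ i < m ] (a i * (c j * M i j)))
      ≡⟨ sum-cong-≗ (λ j → sum-cong-≗ λ i → x∙yz≈y∙xz (a i) (c j) (M i j)) ⟩
    ∑[ j < n ] (∑[ i < m ] (c j * (a i * M i j)))
      ≡⟨ sum-cong-≗ (λ j → *-distribˡ-sum (c j) (λ i → a i * M i j)) ⟨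
    ∑[ j < n ] (c j * ∑[ i < m ] (a i * M i j)) ∎

  inverse : ∀ x → x ≢ 0# → ∃[ y ] y * x ≡ 1#
  inverse x x≢0 with y , yx≡1 , _ ← invertible x x≢0 = y , yx≡1

  *-cancelˡ : ∀ {x y z} → x ≢ 0# → x * y ≡ x * z → y ≡ z
  *-cancelˡ {x} {y} {z} x≢0 xy≡xz with x⁻¹ , x⁻¹x≡1 ← inverse x x≢0 = begin
    y              ≡⟨ *-identityˡ y ⟨
    1# * y         ≡⟨ cong (_* y) x⁻¹x≡1 ⟨
    x⁻¹ * x * y    ≡⟨ *-assoc x⁻¹ x y ⟩
    x⁻¹ * (x * y)  ≡⟨ cong (x⁻¹ *_) xy≡xz ⟩
    x⁻¹ * (x * z)  ≡⟨ *-assoc x⁻¹ x z ⟨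
    x⁻¹ * x * z    ≡⟨ cong (_* z) x⁻¹x≡1 ⟩
    1# * z         ≡⟨ *-identityˡ z ⟩
    z              ∎

  *-cancel-zero : ∀ {x y} → x ≢ 0# → x * y ≡ 0# → y ≡ 0#
  *-cancel-zero x≢0 xy≡0 = *-cancelˡ x≢0 (trans xy≡0 (sym (zeroʳ _)))

  unit : ∀ {n} → Fin n → Carrier → Fin n → Carrier
  unit i a j with i ≟ j
  ... | yes _ = a
  ... | no  _ = 0#

  unit-≡ : ∀ {n} (i : Fin n) a → unit i a i ≡ a
  unit-≡ i a with i ≟ i
  ... | yes _   = refl
  ... | no  i≢i = contradiction refl i≢i

  unit-≢ : ∀ {n} {i j : Fin n} {a} → i ≢ j → unit i a j ≡ 0#
  unit-≢ {i = i} {j} i≢j with i ≟ j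
  ... | yes i≡j = contradiction i≡j i≢j
  ... | no  _   = refl

  sum-unit : ∀ {n} (i : Fin n) a (f : Vector Carrier n) → ∑[ j < n ] (unit i a j * f j) ≡ a * f i
  sum-unit i a f = trans
    (sum-single i λ j j≢i → trans (cong (_* f j) (unit-≢ (j≢i ∘ sym))) (zeroˡ (f j)))
    (cong (_* f i) (unit-≡ i a))

-- Orders of finite fields and numberings of vectors.

module _ {F : Field} {q : ℕ} (order : HasOrder F q) where
  open Field F

  ≟-fromOrder : DecidableEquality Carrier
  ≟-fromOrder = via-injection (↔⇒↣ order) _≟_

  -- 0 and 1 are two distinct elements. Powers of `q` are therefore strictly increasing, so
  -- cardinalities can be compared through exponents.
  1<order : 1 < q
  1<order = go order
    where
    go : ∀ {q} → HasOrder F q → 1 < q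
    go {zero}        h with () ← Inverse.to h 0#
    go {suc (suc _)} h = s≤s (s≤s z≤n)
    go {suc zero}    h = contradiction
      (Injection.injective (↔⇒↣ h) (trans (unique _) (sym (unique _)))) 0≢1
      where
      unique : (i : Fin 1) → i ≡ zero
      unique zero = refl

funToFin-cong : ∀ {m n} {f g : Fin m → Fin n} → f ≗ g → funToFin f ≡ funToFin g
funToFin-cong {zero}  f≗g = refl
funToFin-cong {suc m} f≗g = cong₂ Fin.combine (f≗g zero) (funToFin-cong (f≗g ∘ suc))

funToFin-injective : ∀ {m n} {f g : Fin m → Fin n} → funToFin f ≡ funToFin g → f ≗ g
funToFin-injective {f = f} {g} eq i = trans (sym (finToFun-funToFin f i))
  (trans (cong (λ c → finToFun c i) eq) (finToFun-funToFin g i))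

-- Additive maps and the pigeonhole principle.

module _ (A B : Field) where
  private
    module A where
      open Field A public
      open FieldProperties A public
    module B where
      open Field B public
      open FieldProperties B public

  -- Taking the decomposition of x up to pointwise equality makes f respect _≗_.
  Additive : ∀ {n} → (Space A n → B.Carrier) → Set
  Additive f = ∀ {x y z} → (∀ i → x i ≡ y i A.+ z i) → f x ≡ f y B.+ f z

  -- Since x = (x - y) + y, a collision of `f` becomes an element of its kernel.
  additive-difference : ∀ {n} {f : Space A n → B.Carrier} → Additive f →
    ∀ {x y} → f x ≡ f y → f (λ i → x i A.+ A.- y i) ≡ B.0#
  additive-difference {f = f} f-add {x} {y} fx≡fy =
    B.+-identityˡ-unique _ (f y) (trans (sym (f-add cancel)) fx≡fy)
    where
    open ≡-Reasoning
    cancel : ∀ i → x i ≡ x i A.+ A.- y i A.+ y i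
    cancel i = begin
      x i                         ≡⟨ A.+-identityʳ _ ⟨
      x i A.+ A.0#                ≡⟨ cong (x i A.+_) (A.-‿inverseˡ _) ⟨
      x i A.+ (A.- y i A.+ y i)   ≡⟨ A.+-assoc _ _ _ ⟨
      x i A.+ A.- y i A.+ y i     ∎

  additive-sum : ∀ {m n} {f : Fin m → Space A n → B.Carrier} →
    (∀ i → Additive (f i)) → Additive (λ x → B.sum (λ i → f i x))
  additive-sum {f = f} f-add {x} {y} {z} x≡y+z =
    trans (B.sum-cong-≗ λ i → f-add i x≡y+z) (B.∑-distrib-+ (λ i → f i y) (λ i → f i z))

  additive-+ : ∀ {n} {f g : Space A n → B.Carrier} →
    Additive f → Additive g → Additive (λ x → f x B.+ g x)
  additive-+ f-add g-add x≡y+z = trans (cong₂ B._+_ (f-add x≡y+z) (g-add x≡y+z)) (B.interchange _ _ _ _)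

  additive-* : ∀ {n} {f : Space A n → B.Carrier} {b} → Additive f → Additive (λ x → b B.* f x)
  additive-* {b = b} f-add x≡y+z = trans (cong (b B.*_) (f-add x≡y+z)) (B.distribˡ b _ _)

  -- Two distinct vectors collide by the pigeonhole principle, and their difference is the kernel
  -- vector. With two fields `A` and `B`, the lemma covers `F`-linear maps between spaces over `F`
  -- and over `K`.
  nontrivial-kernel : ∀ {a b} → HasOrder A a → HasOrder B b →
    ∀ {m n} → b ^ n < a ^ m → (f : Space A m → Space B n) → (∀ j → Additive (λ x → f x j)) →
    ∃[ x ] ∃ λ i → x i ≢ A.0# × f x ≗ λ _ → B.0#
  nontrivial-kernel {a} {b} hA hB {m} {n} bⁿ<aᵐ f f-add
    with s , t , s<t , eq ← pigeonhole bⁿ<aᵐ (λ s → funToFin (Inverse.to hB ∘ f (Inverse.from hA ∘ finToFun s)))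
    -- Distinct numbers below `a ^ m` have distinct digit sequences, so the two colliding vectors
    -- differ in some coordinate.
    with all? (λ i → finToFun {a} {m} s i ≟ finToFun t i)
  ... | yes s≗t = contradiction s≡t (<⇒≢ s<t)
    where
    s≡t : s ≡ t
    s≡t = trans (sym (funToFin-finToFin {m} {a} s))
            (trans (funToFin-cong s≗t) (funToFin-finToFin {m} {a} t))
  ... | no s≇t with i , sᵢ≢tᵢ ← ¬∀⟶∃¬ m _ (λ i → finToFun {a} {m} s i ≟ finToFun t i) s≇t =
    _ , i
    , (λ d≡0 → sᵢ≢tᵢ (Injection.injective (↔⇒↣ (↔-sym hA)) (A.x∙y⁻¹≈ε⇒x≈y _ _ d≡0)))
    , λ j → additive-difference (f-add j) (Injection.injective (↔⇒↣ hB) (funToFin-injective eq j))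

-- Coordinates over the small field and rank supports.

module Coordinates {F K : Field} {E : Extension F K} {m : ℕ} (Γ : OrderedBasis E m) where
  open Extension E
  open IsRingHomomorphism isHomomorphism using (+-homo; *-homo; 1#-homo; 0#-homo)
  open OrderedBasis Γ
  open RankMetric Γ using (rankSupport)
  private
    module F where
      open Field F public
      open FieldProperties F public
    module K where
      open Field K public
      open FieldProperties K public
      open CoordinateSpace K public using (linearCombination)
  open ≡-Reasoning

  coord : Fin m → K.Carrier → F.Carrier
  coord j x = proj₁ (spanning x) j

  -- The value of the `F`-linear relation `a` on the entries of `v`. It vanishes exactly when `a` is
  -- orthogonal to the rank support of `v`.
  pairing : ∀ {n} → Space F n → Space K n → K.Carrier
  pairing a v = K.sum (λ i → embed (a i) K.* v i)

  pairing-additive : ∀ {n} (v : Space K n) → Additive F K (λ a → pairing a v)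
  pairing-additive v = additive-sum F K λ i x≡y+z → trans
    (cong (λ a → embed a K.* v i) (x≡y+z i))
    (trans (cong (K._* v i) (+-homo _ _)) (K.distribʳ (v i) _ _))

  -- `coord` is read from the witness chosen by `spanning`; independence of the basis makes any
  -- other expansion agree with it.
  coord-unique : ∀ {x a} → x ≡ combine a → ∀ j → coord j x ≡ a j
  coord-unique {x} x≡a j = F.x∙y⁻¹≈ε⇒x≈y _ _
    (independent _ (additive-difference F K (pairing-additive γ) (trans (sym (proj₂ (spanning x))) x≡a)) j)

  coord-+ : ∀ j x y → coord j (x K.+ y) ≡ coord j x F.+ coord j y
  coord-+ j x y = coord-unique
    (trans (cong₂ K._+_ (proj₂ (spanning x)) (proj₂ (spanning y))) (sym (pairing-additive γ λ _ → refl))) j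

  coord-* : ∀ j a x → coord j (embed a K.* x) ≡ a F.* coord j x
  coord-* j a x = coord-unique scaled j
    where
    scaled : embed a K.* x ≡ combine (λ l → a F.* coord l x)
    scaled = begin
      embed a K.* x
        ≡⟨ cong (embed a K.*_) (proj₂ (spanning x)) ⟩
      embed a K.* combine (λ l → coord l x)
        ≡⟨ K.*-distribˡ-sum (embed a) (λ l → embed (coord l x) K.* γ l) ⟩
      K.sum (λ l → embed a K.* (embed (coord l x) K.* γ l))
        ≡⟨ K.sum-cong-≗ (λ l → trans (cong (K._* γ l) (*-homo a (coord l x))) (K.*-assoc _ _ _)) ⟨
      combine (λ l → a F.* coord l x) ∎

  coord-0 : ∀ j → coord j K.0# ≡ F.0#
  coord-0 = coord-unique
    (sym (K.sum-zero λ j → trans (cong (K._* γ j) 0#-homo) (K.zeroˡ (γ j))))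

  pairing-unit : ∀ {n} i (v : Space K n) → pairing (F.unit i F.1#) v ≡ v i
  pairing-unit i v = begin
    pairing (F.unit i F.1#) v
      ≡⟨ K.sum-single i (λ j j≢i → trans
           (cong (K._* v j) (trans (cong embed (F.unit-≢ (j≢i ∘ sym))) 0#-homo)) (K.zeroˡ (v j))) ⟩
    embed (F.unit i F.1# i) K.* v i
      ≡⟨ cong (K._* v i) (trans (cong embed (F.unit-≡ i F.1#)) 1#-homo) ⟩
    K.1# K.* v i
      ≡⟨ K.*-identityˡ (v i) ⟩
    v i ∎

  coord-γ : ∀ l j → coord j (γ l) ≡ F.unit l F.1# j
  coord-γ l = coord-unique (sym (pairing-unit l γ))

  coord-γ-≡ : ∀ l → coord l (γ l) ≡ F.1#
  coord-γ-≡ l = trans (coord-γ l l) (F.unit-≡ l F.1#)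

  coord-γ-≢ : ∀ {l j} → l ≢ j → coord j (γ l) ≡ F.0#
  coord-γ-≢ {l} {j} l≢j = trans (coord-γ l j) (F.unit-≢ l≢j)

  γ≢0 : ∀ l → γ l ≢ K.0#
  γ≢0 l γ≡0 = F.0≢1 (begin
    F.0#            ≡⟨ coord-0 l ⟨
    coord l K.0#    ≡⟨ cong (coord l) γ≡0 ⟨
    coord l (γ l)   ≡⟨ coord-γ-≡ l ⟩
    F.1#            ∎)

  coord-sum : ∀ {n} j (f : Vector K.Carrier n) → coord j (K.sum f) ≡ F.sum (coord j ∘ f)
  coord-sum {zero}  j f = coord-0 j
  coord-sum {suc n} j f = trans (coord-+ j _ _) (cong (coord j (f zero) F.+_) (coord-sum j (f ∘ suc)))

  coords-zero : ∀ {x} → (∀ j → coord j x ≡ F.0#) → x ≡ K.0#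
  coords-zero {x} x≡0 = trans (proj₂ (spanning x))
    (K.sum-zero λ j → trans (cong (K._* γ j) (trans (cong embed (x≡0 j)) 0#-homo)) (K.zeroˡ (γ j)))

  coord-additive : ∀ A {n} {f : Space A n → K.Carrier} → Additive A K f →
    ∀ j → Additive A F (coord j ∘ f)
  coord-additive A f-add j x≡y+z = trans (cong (coord j) (f-add x≡y+z)) (coord-+ j _ _)

  coord-pairing : ∀ {n} j (a : Space F n) v → coord j (pairing a v) ≡ F.sum (λ i → a i F.* coord j (v i))
  coord-pairing j a v = trans (coord-sum j (λ i → embed (a i) K.* v i)) (F.sum-cong-≗ λ i → coord-* j (a i) (v i))

  pairing-linearCombination : ∀ {n k} (a : Space F n) (y : Space K k) (b : Vector (Space K n) k) →
    pairing a (K.linearCombination y b) ≡ K.sum (λ j → y j K.* pairing a (b j))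
  pairing-linearCombination a y b = K.∑-*-comm (embed ∘ a) y (λ i j → b j i)

  -- A larger support satisfies fewer relations: `a` is orthogonal to every column of `v`, hence to
  -- the columns of `v′`, which are combinations of them.
  rankSupport-relations : ∀ {n} {v v′ : Space K n} → rankSupport v′ ⊆ rankSupport v →
    ∀ a → pairing a v ≡ K.0# → pairing a v′ ≡ K.0#
  rankSupport-relations {n} {v} {v′} σ′⊆σ a av≡0 = coords-zero column
    where
    column : ∀ j → coord j (pairing a v′) ≡ F.0#
    -- The coefficients `F.unit j F.1#` exhibit column `j` of `v′` as an element of its support; the
    -- inclusion then writes it in the columns of `v` with coefficients `c`.
    column j with c , eq ← σ′⊆σ {λ i → coord j (v′ i)} (F.unit j F.1# ,
        λ i → sym (trans (F.sum-unit j F.1# _) (F.*-identityˡ _))) = begin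
      coord j (pairing a v′)
        ≡⟨ coord-pairing j a v′ ⟩
      F.sum (λ i → a i F.* coord j (v′ i))
        ≡⟨ F.sum-cong-≗ (λ i → cong (a i F.*_) (eq i)) ⟩
      F.sum (λ i → a i F.* F.sum (λ l → c l F.* coord l (v i)))
        ≡⟨ F.∑-*-comm a c (λ i l → coord l (v i)) ⟩
      F.sum (λ l → c l F.* F.sum (λ i → a i F.* coord l (v i)))
        ≡⟨ F.sum-zero (λ l → trans
             (cong (c l F.*_) (trans (sym (coord-pairing l a v)) (trans (cong (coord l) av≡0) (coord-0 l))))
             (F.zeroʳ (c l))) ⟩
      F.0# ∎

-- Linear combinations, dimension and length.

module _ (K : Field) where
  open Field K
  open FieldProperties K
  open CoordinateSpace K using (linearCombination; HasDimension)

  linearCombination-∈ : ∀ {n} {C : Pred (Space K n) 0ℓ} → IsSubspace K C →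
    ∀ {k} {b : Vector (Space K n) k} → (∀ j → b j ∈ C) → ∀ c → linearCombination c b ∈ C
  linearCombination-∈ C-subspace {zero}  b∈C c = IsSubspace.0-closed C-subspace
  linearCombination-∈ C-subspace {suc k} b∈C c = IsSubspace.+-closed C-subspace
    (IsSubspace.*-closed C-subspace (c zero) (b∈C zero))
    (linearCombination-∈ C-subspace (b∈C ∘ suc) (c ∘ suc))

  linearCombination-additive : ∀ {k n} (b : Vector (Space K n) k) i →
    Additive K K (λ c → linearCombination c b i)
  linearCombination-additive b i = additive-sum K K λ j x≡y+z →
    trans (cong (_* b j i) (x≡y+z j)) (distribʳ (b j i) _ _)

  -- If n < k, counting gives a nonzero vector of coefficients with zero combination, against the
  -- independence of the basis.
  dimension≤length : ∀ {r} → HasOrder K r → ∀ {n k} {C : Pred (Space K n) 0ℓ} → HasDimension C k → k ≤ n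
  dimension≤length {r} hK (b , b-basis) = ℕₚ.≮⇒≥ λ n<k →
    let c , j , cⱼ≢0 , cb≗0 = nontrivial-kernel K K hK hK (ℕₚ.^-monoʳ-< r (1<order {F = K} hK) n<k)
                                (λ c → linearCombination c b) (linearCombination-additive b)
    in cⱼ≢0 (IsBasis.independent b-basis c cb≗0 j)

-- Extensions of degree two.

module _ {F K : Field} {E : Extension F K} (Γ : OrderedBasis E 2) where
  open Coordinates Γ
  open RankMetric Γ
  private
    module F where
      open Field F public
      open FieldProperties F public
    module K where
      open Field K public
      open FieldProperties K public
      open CoordinateSpace K public using (linearCombination)

  -- If v = γ₀ w for some w over F, and v′ = γ₁ w′, then the support of v is spanned by w
  -- and that of v + v′ by w and w′.
  rankSupport-+ : ∀ {n} {v v′ : Space K n} →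
    (∀ i → coord 1F (v i) ≡ F.0#) → (∀ i → coord 0F (v′ i) ≡ F.0#) →
    rankSupport v ⊆ rankSupport (λ i → v i K.+ v′ i)
  rankSupport-+ {v = v} {v′} v₁≡0 v′₀≡0 (c , w≗) =
    (c 0F ∷ F.0# ∷ []) , λ i → trans (w≗ i) (cong₂ F._+_ (first i) (cong (F._+ F.0#) (second i)))
    where
    first : ∀ i → c 0F F.* coord 0F (v i) ≡ c 0F F.* coord 0F (v i K.+ v′ i)
    first i = cong (c 0F F.*_) (sym (trans (coord-+ 0F (v i) (v′ i))
      (trans (cong (coord 0F (v i) F.+_) (v′₀≡0 i)) (F.+-identityʳ _))))
    second : ∀ i → c 1F F.* coord 1F (v i) ≡ F.0# F.* coord 1F (v i K.+ v′ i)
    second i = trans (trans (cong (c 1F F.*_) (v₁≡0 i)) (F.zeroʳ (c 1F))) (sym (F.zeroˡ _))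

  -- Forcing a codeword into γ₀ F^n or γ₁ F^n costs `n` conditions over `F`. The hypothesis leaves
  -- room for one more, which makes the second codeword vanish at an entry where the first does not.
  quadratic-not-minimal : ∀ {q r} → HasOrder F q → HasOrder K r →
    ∀ {n k} → q ^ suc n < r ^ k → (C : Code n k) → ¬ Minimal C
  quadratic-not-minimal {q} hF hK {n} qⁿ⁺¹<rᵏ C minimal
    with b , b-basis ← Code.dimension C
    with c , j , cⱼ≢0 , c-ker ← nontrivial-kernel K F hK hF
           (ℕₚ.<-trans (ℕₚ.^-monoʳ-< q (1<order {F = F} hF) (ℕₚ.n<1+n n)) qⁿ⁺¹<rᵏ)
           (λ c i → coord 1F (K.linearCombination c b i))
           (λ i → coord-additive K (linearCombination-additive K b i) 1F)
    with i , vᵢ≢0 ← ¬∀⟶∃¬ n _ (λ i → ≟-fromOrder {F = K} hK (K.linearCombination c b i) K.0#)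
           (λ v≡0 → cⱼ≢0 (IsBasis.independent b-basis c v≡0 j))
    -- The head is the extra condition: it kills the γ₁ coordinate of entry `i`, whose γ₀ coordinate
    -- vanishes by the tail.
    with c′ , j′ , c′ⱼ≢0 , c′-ker ← nontrivial-kernel K F hK hF qⁿ⁺¹<rᵏ
           (λ c′ → coord 1F (K.linearCombination c′ b i) ∷ λ l → coord 0F (K.linearCombination c′ b l))
           (λ { zero    → coord-additive K (linearCombination-additive K b i) 1F
              ; (suc l) → coord-additive K (linearCombination-additive K b l) 0F })
    = conclude (minimal (IsSubspace.+-closed C-subspace v∈C v′∈C) v∈C
        (rankSupport-+ c-ker (c′-ker ∘ suc)))
    where
    C-subspace : IsSubspace K (Code.codewords C)
    C-subspace = Code.isSubspace C

    v v′ : Space K n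
    v  = K.linearCombination c b
    v′ = K.linearCombination c′ b

    v∈C : v ∈ Code.codewords C
    v∈C = linearCombination-∈ K C-subspace (IsBasis.members b-basis) c

    v′∈C : v′ ∈ Code.codewords C
    v′∈C = linearCombination-∈ K C-subspace (IsBasis.members b-basis) c′

    v′ᵢ≡0 : v′ i ≡ K.0#
    v′ᵢ≡0 = coords-zero λ { 0F → c′-ker (suc i) ; 1F → c′-ker zero }

    -- At entry `i` the equation reads v = β v with v nonzero, so β = 1. Then v′ = 0 everywhere,
    -- although `c′` is nonzero.
    conclude : ¬ (∃[ β ] v ≗ λ l → β K.* (v l K.+ v′ l))
    conclude (β , v≗) = c′ⱼ≢0 (IsBasis.independent b-basis c′ v′≡0 j′)
      where
      open ≡-Reasoning

      β≡1 : β ≡ K.1#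
      β≡1 = K.*-cancelˡ vᵢ≢0 (begin
        v i K.* β               ≡⟨ K.*-comm (v i) β ⟩
        β K.* v i               ≡⟨ cong (β K.*_) (trans (cong (v i K.+_) v′ᵢ≡0) (K.+-identityʳ (v i))) ⟨
        β K.* (v i K.+ v′ i)    ≡⟨ v≗ i ⟨
        v i                     ≡⟨ K.*-identityʳ (v i) ⟨
        v i K.* K.1#            ∎)

      v′≡0 : ∀ l → v′ l ≡ K.0#
      v′≡0 l = K.+-identityʳ-unique (v l) (v′ l) (begin
        v l K.+ v′ l              ≡⟨ K.*-identityˡ _ ⟨
        K.1# K.* (v l K.+ v′ l)   ≡⟨ cong (K._* (v l K.+ v′ l)) β≡1 ⟨
        β K.* (v l K.+ v′ l)      ≡⟨ v≗ l ⟨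
        v l                       ∎)

-- Codes whose generator columns are basis multiples of unit vectors.

module MonomialCode {F K : Field} {E : Extension F K} {m : ℕ} (Γ : OrderedBasis E m) {n k : ℕ}
  (pos : Fin n → Fin (suc k) × Fin m)
  (pos-injective : ∀ {i i′} → pos i ≡ pos i′ → i ≡ i′)
  (row-occurs : ∀ j → ∃[ i ] proj₁ (pos i) ≡ j) where

  open Extension E
  open IsRingHomomorphism isHomomorphism using (0#-homo)
  open OrderedBasis Γ using (γ)
  open Coordinates Γ
  open RankMetric Γ
  private
    module F where
      open Field F public
      open FieldProperties F public
    module K where
      open Field K public
      open FieldProperties K public
      open CoordinateSpace K public using (linearCombination)
  open ≡-Reasoning

  -- If pos i = (j , l), then column i of the generator matrix is γ_l e_j.
  generator : Vector (Space K n) (suc k)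
  generator j i = K.unit (proj₁ (pos i)) (γ (proj₂ (pos i))) j

  encode : Space K (suc k) → Space K n
  encode y = K.linearCombination y generator

  encode-entry : ∀ y i → encode y i ≡ y (proj₁ (pos i)) K.* γ (proj₂ (pos i))
  encode-entry y i = begin
    K.sum (λ j → y j K.* generator j i)  ≡⟨ K.sum-cong-≗ (λ j → K.*-comm (y j) (generator j i)) ⟩
    K.sum (λ j → generator j i K.* y j)  ≡⟨ K.sum-unit (proj₁ (pos i)) (γ (proj₂ (pos i))) y ⟩
    γ (proj₂ (pos i)) K.* y (proj₁ (pos i))  ≡⟨ K.*-comm _ _ ⟩
    y (proj₁ (pos i)) K.* γ (proj₂ (pos i))  ∎

  -- Each row contains a nonzero entry that is alone in its column, so every coordinate of `y` can
  -- be read off the codeword.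
  generator-independent : ∀ y → encode y ≗ (λ _ → K.0#) → ∀ j → y j ≡ K.0#
  generator-independent y y≡0 j with i , refl ← row-occurs j =
    K.*-cancel-zero (γ≢0 (proj₂ (pos i)))
      (trans (K.*-comm _ _) (trans (sym (encode-entry y i)) (y≡0 i)))

  code : Code n (suc k)
  code = record
    { codewords  = λ v → ∃[ y ] v ≗ encode y
    ; isSubspace = record
      { respects = λ { u≗v (y , u≗) → y , λ i → trans (sym (u≗v i)) (u≗ i) }
      ; 0-closed = (λ _ → K.0#) , λ i → sym (K.sum-zero λ j → K.zeroˡ (generator j i))
      ; +-closed = λ { (y , u≗) (z , v≗) → (λ j → y j K.+ z j) , λ i →
          trans (cong₂ K._+_ (u≗ i) (v≗ i)) (sym (linearCombination-additive K generator i {y = y} {z} λ _ → refl)) }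
      ; *-closed = λ { a (y , v≗) → (λ j → a K.* y j) , λ i →
          trans (cong (a K.*_) (v≗ i)) (encode-* a y i) }
      }
    ; dimension  = generator , record
      { members     = λ j → K.unit j K.1# , λ i →
          sym (trans (K.sum-unit j K.1# (λ l → generator l i)) (K.*-identityˡ (generator j i)))
      ; independent = generator-independent
      ; spanning    = λ v∈ → v∈
      }
    }
    where
    encode-* : ∀ a y i → a K.* encode y i ≡ encode (λ j → a K.* y j) i
    encode-* a y i = trans (K.*-distribˡ-sum a (λ j → y j K.* generator j i))
      (K.sum-cong-≗ λ j → sym (K.*-assoc a (y j) (generator j i)))

  -- In the `F`-basis γ_l e_j of the ambient space, column `i` is the basis vector indexed by
  -- `pos i`; this lemma and the next give its coordinates.
  coord-generator-≡ : ∀ i → coord (proj₂ (pos i)) (generator (proj₁ (pos i)) i) ≡ F.1#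
  coord-generator-≡ i = trans (cong (coord (proj₂ (pos i))) (K.unit-≡ (proj₁ (pos i)) _)) (coord-γ-≡ _)

  coord-generator-≢ : ∀ i j l → pos i ≢ (j , l) → coord l (generator j i) ≡ F.0#
  coord-generator-≢ i j l pos≢ with proj₁ (pos i) ≟ j
  ... | no  _  = coord-0 l
  ... | yes eq = coord-γ-≢ λ eq′ → pos≢ (cong₂ _,_ eq eq′)

  -- By injectivity of `pos`, the pair `pos t` belongs to column `t` only. The expansion of the row
  -- containing it therefore has the unit vector e_t as a column, and `w` is the sum of the w_t e_t.
  nondegenerate : Nondegenerate code
  nondegenerate w = n , row , (λ t → F.unit t (w t)) , row∈code , unit∈support , decomposition
    where
    row : Fin n → Space K n
    row t = generator (proj₁ (pos t))

    row∈code : ∀ t → row t ∈ Code.codewords code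
    row∈code t = IsBasis.members (proj₂ (Code.dimension code)) (proj₁ (pos t))

    unit∈support : ∀ t → F.unit t (w t) ∈ rankSupport (row t)
    unit∈support t = F.unit (proj₂ (pos t)) (w t) , λ i → sym (trans
      (F.sum-unit (proj₂ (pos t)) (w t) (λ l → coord l (row t i))) (entry i))
      where
      entry : ∀ i → w t F.* coord (proj₂ (pos t)) (row t i) ≡ F.unit t (w t) i
      entry i with t ≟ i
      ... | yes refl = trans (cong (w t F.*_) (coord-generator-≡ t)) (F.*-identityʳ (w t))
      ... | no t≢i   = trans
        (cong (w t F.*_) (coord-generator-≢ i (proj₁ (pos t)) (proj₂ (pos t)) (t≢i ∘ sym ∘ pos-injective)))
        (F.zeroʳ (w t))

    decomposition : ∀ i → w i ≡ F.sum (λ t → F.unit t (w t) i)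
    decomposition i = sym (trans (F.sum-single i λ t t≢i → F.unit-≢ t≢i) (F.unit-≡ i (w i)))

  -- As a ranges over F^n this is the F-span of the columns of the generator matrix.
  columns : Space F n → Space K (suc k)
  columns a j = pairing a (generator j)

  columns-missing : ∀ {j l} → (∀ i → pos i ≢ (j , l)) → ∀ a → coord l (columns a j) ≡ F.0#
  columns-missing {j} {l} missing a = trans (coord-pairing l a (generator j))
    (F.sum-zero λ i → trans (cong (a i F.*_) (coord-generator-≢ i j l (missing i))) (F.zeroʳ (a i)))

  -- The coordinate of `columns a` at the pair `pos i` is exactly `a i`, since no other column
  -- reaches that pair.
  columns-injective : ∀ a → (∀ j → columns a j ≡ K.0#) → ∀ i → a i ≡ F.0#
  columns-injective a a≡0 i = begin
    a i
      ≡⟨ F.*-identityʳ (a i) ⟨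
    a i F.* F.1#
      ≡⟨ cong (a i F.*_) (coord-generator-≡ i) ⟨
    a i F.* coord l (generator j i)
      ≡⟨ F.sum-single i (λ i′ i′≢i → trans
           (cong (a i′ F.*_) (coord-generator-≢ i′ j l (i′≢i ∘ pos-injective))) (F.zeroʳ (a i′))) ⟨
    F.sum (λ i′ → a i′ F.* coord l (generator j i′))
      ≡⟨ coord-pairing l a (generator j) ⟨
    coord l (columns a j)
      ≡⟨ cong (coord l) (a≡0 j) ⟩
    coord l K.0#
      ≡⟨ coord-0 l ⟩
    F.0# ∎
    where
    j = proj₁ (pos i)
    l = proj₂ (pos i)

  dot : Space K (suc k) → Space K (suc k) → K.Carrier
  dot y x = K.sum (λ j → y j K.* x j)

  -- The last clause says that `z` lies outside the `F`-span of the columns, in the form that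
  -- refutes a kernel vector with head `t` and tail `a`.
  Escape : Space K (suc k) → Space K (suc k) → Set
  Escape y y′ = ∃[ z ] dot y z ≡ K.0# × dot y′ z ≡ K.0# ×
    (∀ t a → (∀ j → embed t K.* z j K.+ columns a j ≡ K.0#) → t ≡ F.0#)

  -- Proportionality is stated without division so that a factor may vanish, as `x j` does at the
  -- end of `orthogonal`.
  dot-cross : ∀ {x s : Space K (suc k)} {p q} → (∀ j → p K.* x j ≡ q K.* s j) →
    ∀ w → p K.* dot w x ≡ q K.* dot w s
  dot-cross {x} {s} {p} {q} px≡qs w = begin
    p K.* dot w x                      ≡⟨ K.*-distribˡ-sum p (λ j → w j K.* x j) ⟩
    K.sum (λ j → p K.* (w j K.* x j))  ≡⟨ K.sum-cong-≗ (λ j → K.x∙yz≈y∙xz p (w j) (x j)) ⟩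
    K.sum (λ j → w j K.* (p K.* x j))  ≡⟨ K.sum-cong-≗ (λ j → cong (w j K.*_) (px≡qs j)) ⟩
    K.sum (λ j → w j K.* (q K.* s j))  ≡⟨ K.sum-cong-≗ (λ j → K.x∙yz≈y∙xz q (w j) (s j)) ⟨
    K.sum (λ j → q K.* (w j K.* s j))  ≡⟨ K.*-distribˡ-sum q (λ j → w j K.* s j) ⟨
    q K.* dot w s                      ∎

  dot-scale : ∀ y a z → dot y (λ j → a K.* z j) ≡ a K.* dot y z
  dot-scale y a z = trans (sym (K.*-identityˡ _)) (dot-cross (λ j → K.*-identityˡ (a K.* z j)) y)

  dot-translate : ∀ y a z x → dot y z ≡ K.0# → dot y (λ j → a K.* z j K.+ x j) ≡ dot y x
  dot-translate y a z x yz≡0 = begin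
    dot y (λ j → a K.* z j K.+ x j)
      ≡⟨ K.sum-cong-≗ (λ j → K.distribˡ (y j) (a K.* z j) (x j)) ⟩
    K.sum (λ j → y j K.* (a K.* z j) K.+ y j K.* x j)
      ≡⟨ K.∑-distrib-+ (λ j → y j K.* (a K.* z j)) (λ j → y j K.* x j) ⟩
    dot y (λ j → a K.* z j) K.+ dot y x
      ≡⟨ cong (K._+ dot y x) (trans (dot-scale y a z) (trans (cong (a K.*_) yz≡0) (K.zeroʳ a))) ⟩
    K.0# K.+ dot y x
      ≡⟨ K.+-identityˡ _ ⟩
    dot y x ∎

  module _ {q r} (hF : HasOrder F q) (hK : HasOrder K r) (rᵏ<qⁿ⁺¹ : r ^ k < q ^ suc n)
    (escape : ∀ y y′ → Escape y y′) where

    -- The vectors x in F z + columns meet the line K s in a nonzero vector: their images in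
    -- K^(k+1) / K s, written in coordinates that omit j, satisfy the cardinality bound.
    orthogonal : ∀ {y y′} → (∀ a → dot y (columns a) ≡ K.0# → dot y′ (columns a) ≡ K.0#) →
      ∀ s j → s j ≢ K.0# → dot y s ≡ K.0# → dot y′ s ≡ K.0#
    orthogonal {y} {y′} relations s j sⱼ≢0 ys≡0 = decidable-stable (≟-fromOrder {F = K} hK _ _) contradict
      where
      contradict : ¬ (dot y′ s ≢ K.0#)
      contradict y′s≢0
        with z , yz≡0 , y′z≡0 , z-escapes ← escape y y′
        -- The map sends x = t z + u to the minors s_j x_l - s_l x_j for l ≠ j; the head of `d` is
        -- the coefficient t, and its tail gives u.
        with d , i , dᵢ≢0 , d-ker ← nontrivial-kernel F K hF hK rᵏ<qⁿ⁺¹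
               (λ d l → s j K.* pairing d (z (punchIn j l) ∷ generator (punchIn j l))
                        K.+ K.- s (punchIn j l) K.* pairing d (z j ∷ generator j))
               (λ l → additive-+ F K (additive-* F K (pairing-additive (z (punchIn j l) ∷ generator (punchIn j l))))
                                 (additive-* F K (pairing-additive (z j ∷ generator j))))
        = dᵢ≢0 (d≡0 i)
        where
        t : F.Carrier
        t = d zero

        a : Space F n
        a = d ∘ suc

        x : Space K (suc k)
        x l = embed t K.* z l K.+ columns a l

        parallel-≢ : ∀ l → s j K.* x (punchIn j l) ≡ x j K.* s (punchIn j l)
        parallel-≢ l = K.x∙y⁻¹≈ε⇒x≈y _ _ (begin
          s j K.* x (punchIn j l) K.+ K.- (x j K.* s (punchIn j l))
            ≡⟨ cong (λ e → s j K.* x (punchIn j l) K.+ K.- e) (K.*-comm (x j) (s (punchIn j l))) ⟩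
          s j K.* x (punchIn j l) K.+ K.- (s (punchIn j l) K.* x j)
            ≡⟨ cong (s j K.* x (punchIn j l) K.+_) (K.-‿distribˡ-* (s (punchIn j l)) (x j)) ⟩
          s j K.* x (punchIn j l) K.+ K.- s (punchIn j l) K.* x j
            ≡⟨ d-ker l ⟩
          K.0# ∎)

        parallel : ∀ l → s j K.* x l ≡ x j K.* s l
        parallel l with j ≟ l
        ... | yes refl = K.*-comm (s j) (x j)
        ... | no j≢l   = subst (λ l → s j K.* x l ≡ x j K.* s l) (punchIn-punchOut j≢l)
                           (parallel-≢ (punchOut j≢l))

        -- Being parallel to s, x is orthogonal to y, and so is its part u because z is. The
        -- relations carry this over to y′. As y′ · s ≠ 0, x must be the zero multiple of s.
        yx≡0 : dot y x ≡ K.0#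
        yx≡0 = K.*-cancel-zero sⱼ≢0
          (trans (dot-cross parallel y) (trans (cong (x j K.*_) ys≡0) (K.zeroʳ (x j))))

        y′x≡0 : dot y′ x ≡ K.0#
        y′x≡0 = trans (dot-translate y′ (embed t) z (columns a) y′z≡0)
          (relations a (trans (sym (dot-translate y (embed t) z (columns a) yz≡0)) yx≡0))

        xⱼ≡0 : x j ≡ K.0#
        xⱼ≡0 = K.*-cancel-zero y′s≢0 (begin
          dot y′ s K.* x j   ≡⟨ K.*-comm (dot y′ s) (x j) ⟩
          x j K.* dot y′ s   ≡⟨ dot-cross parallel y′ ⟨
          s j K.* dot y′ x   ≡⟨ cong (s j K.*_) y′x≡0 ⟩
          s j K.* K.0#       ≡⟨ K.zeroʳ (s j) ⟩
          K.0#               ∎)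

        x≡0 : ∀ l → x l ≡ K.0#
        x≡0 l = K.*-cancel-zero sⱼ≢0
          (trans (parallel l) (trans (cong (K._* s l) xⱼ≡0) (K.zeroˡ (s l))))

        t≡0 : t ≡ F.0#
        t≡0 = z-escapes t a x≡0

        a≡0 : ∀ i → a i ≡ F.0#
        a≡0 = columns-injective a λ l → begin
          columns a l                          ≡⟨ K.+-identityˡ _ ⟨
          K.0# K.+ columns a l                 ≡⟨ cong (K._+ columns a l) (K.zeroˡ (z l)) ⟨
          K.0# K.* z l K.+ columns a l         ≡⟨ cong (λ e → e K.* z l K.+ columns a l) 0#-homo ⟨
          embed F.0# K.* z l K.+ columns a l   ≡⟨ cong (λ e → embed e K.* z l K.+ columns a l) t≡0 ⟨
          x l                                  ≡⟨ x≡0 l ⟩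
          K.0#                                 ∎

        d≡0 : ∀ i → d i ≡ F.0#
        d≡0 zero    = t≡0
        d≡0 (suc i) = a≡0 i

    -- Take s = y_i e_j - y_j e_i: it is orthogonal to `y`, and its product with `y′` is the minor
    -- that has to vanish.
    cross-products : ∀ {y y′} → (∀ a → dot y (columns a) ≡ K.0# → dot y′ (columns a) ≡ K.0#) →
      ∀ i → y i ≢ K.0# → ∀ j → y i K.* y′ j ≡ y j K.* y′ i
    cross-products {y} {y′} relations i yᵢ≢0 j with i ≟ j
    ... | yes refl = refl
    ... | no i≢j   = K.x∙y⁻¹≈ε⇒x≈y _ _ (trans (sym (dot-s y′))
        (orthogonal {y} {y′} relations s j sⱼ≢0 (trans (dot-s y) (K.x≈y⇒x∙y⁻¹≈ε (K.*-comm (y i) (y j))))))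
      where
      s : Space K (suc k)
      s l = K.unit j (y i) l K.+ K.unit i (K.- y j) l

      dot-s : ∀ w → dot w s ≡ y i K.* w j K.+ K.- (y j K.* w i)
      dot-s w = begin
        dot w s
          ≡⟨ K.sum-cong-≗ (λ l → trans (K.*-comm (w l) (s l)) (K.distribʳ (w l) _ _)) ⟩
        K.sum (λ l → K.unit j (y i) l K.* w l K.+ K.unit i (K.- y j) l K.* w l)
          ≡⟨ K.∑-distrib-+ (λ l → K.unit j (y i) l K.* w l) (λ l → K.unit i (K.- y j) l K.* w l) ⟩
        K.sum (λ l → K.unit j (y i) l K.* w l) K.+ K.sum (λ l → K.unit i (K.- y j) l K.* w l)
          ≡⟨ cong₂ K._+_ (K.sum-unit j (y i) w) (K.sum-unit i (K.- y j) w) ⟩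
        y i K.* w j K.+ K.- y j K.* w i
          ≡⟨ cong (y i K.* w j K.+_) (K.-‿distribˡ-* (y j) (w i)) ⟨
        y i K.* w j K.+ K.- (y j K.* w i) ∎

      sⱼ≢0 : s j ≢ K.0#
      sⱼ≢0 sⱼ≡0 = yᵢ≢0 (begin
        y i                                     ≡⟨ K.+-identityʳ (y i) ⟨
        y i K.+ K.0#                            ≡⟨ cong₂ K._+_ (K.unit-≡ j (y i)) (K.unit-≢ i≢j) ⟨
        s j                                     ≡⟨ sⱼ≡0 ⟩
        K.0#                                    ∎)

    -- Pairing a codeword with `a` equals the product of its message with `columns a`, so the
    -- inclusion of supports becomes `relations`. Vanishing minors then make `y′` a multiple of `y`.
    minimal : Minimal code
    minimal {v} {v′} (y , v≗) (y′ , v′≗) σ′⊆σ = conclude (all? λ i → ≟-fromOrder {F = K} hK (y i) K.0#)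
      where
      pairing-codeword : ∀ x {u} → u ≗ encode x → ∀ a → pairing a u ≡ dot x (columns a)
      pairing-codeword x u≗ a = trans (K.sum-cong-≗ λ i → cong (embed (a i) K.*_) (u≗ i))
        (pairing-linearCombination a x generator)

      relations : ∀ a → dot y (columns a) ≡ K.0# → dot y′ (columns a) ≡ K.0#
      relations a yu≡0 = trans (sym (pairing-codeword y′ v′≗ a))
        (rankSupport-relations σ′⊆σ a (trans (pairing-codeword y v≗ a) yu≡0))

      conclude : Dec (∀ i → y i ≡ K.0#) → ∃[ α ] v′ ≗ λ i → α K.* v i
      -- The zero message satisfies all relations, in particular the unit vectors, which read off
      -- the single entries of `v′`.
      conclude (yes y≡0) = K.0# , λ i → begin
        v′ i                                ≡⟨ pairing-unit i v′ ⟨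
        pairing (F.unit i F.1#) v′          ≡⟨ pairing-codeword y′ v′≗ (F.unit i F.1#) ⟩
        dot y′ (columns (F.unit i F.1#))    ≡⟨ relations (F.unit i F.1#) (K.sum-zero λ j →
                                                 trans (cong (K._* columns (F.unit i F.1#) j) (y≡0 j)) (K.zeroˡ _)) ⟩
        K.0#                                ≡⟨ K.zeroˡ (v i) ⟨
        K.0# K.* v i                        ∎
      conclude (no y≢0)
        with i , yᵢ≢0 ← ¬∀⟶∃¬ (suc k) _ (λ i → ≟-fromOrder {F = K} hK (y i) K.0#) y≢0
        with yᵢ⁻¹ , yᵢ⁻¹yᵢ≡1 ← K.inverse (y i) yᵢ≢0 = yᵢ⁻¹ K.* y′ i , λ e → K.*-cancelˡ yᵢ≢0 (begin
          y i K.* v′ e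
            ≡⟨ cong (y i K.*_) (v′≗ e) ⟩
          y i K.* dot y′ (λ j → generator j e)
            ≡⟨ K.*-distribˡ-sum (y i) (λ j → y′ j K.* generator j e) ⟩
          K.sum (λ j → y i K.* (y′ j K.* generator j e))
            ≡⟨ K.sum-cong-≗ (λ j → cross j (generator j e)) ⟩
          K.sum (λ j → y′ i K.* (y j K.* generator j e))
            ≡⟨ K.*-distribˡ-sum (y′ i) (λ j → y j K.* generator j e) ⟨
          y′ i K.* dot y (λ j → generator j e)
            ≡⟨ cong (y′ i K.*_) (v≗ e) ⟨
          y′ i K.* v e
            ≡⟨ K.*-identityˡ _ ⟨
          K.1# K.* (y′ i K.* v e)
            ≡⟨ cong (K._* (y′ i K.* v e)) (trans (sym yᵢ⁻¹yᵢ≡1) (K.*-comm yᵢ⁻¹ (y i))) ⟩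
          y i K.* yᵢ⁻¹ K.* (y′ i K.* v e)
            ≡⟨ K.*-assoc (y i) yᵢ⁻¹ _ ⟩
          y i K.* (yᵢ⁻¹ K.* (y′ i K.* v e))
            ≡⟨ cong (y i K.*_) (K.*-assoc yᵢ⁻¹ (y′ i) (v e)) ⟨
          y i K.* (yᵢ⁻¹ K.* y′ i K.* v e) ∎)
        where
        cross : ∀ j g → y i K.* (y′ j K.* g) ≡ y′ i K.* (y j K.* g)
        cross j g = begin
          y i K.* (y′ j K.* g)   ≡⟨ K.*-assoc (y i) (y′ j) g ⟨
          y i K.* y′ j K.* g     ≡⟨ cong (K._* g) (cross-products {y} {y′} relations i yᵢ≢0 j) ⟩
          y j K.* y′ i K.* g     ≡⟨ cong (K._* g) (K.*-comm (y j) (y′ i)) ⟩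
          y′ i K.* y j K.* g     ≡⟨ K.*-assoc (y′ i) (y j) g ⟩
          y′ i K.* (y j K.* g)   ∎

-- Escaping vectors from three incomplete rows.

module _ {F K : Field} {E : Extension F K} {m : ℕ} (Γ : OrderedBasis E m) {r : ℕ} (hK : HasOrder K r)
  {n k : ℕ} (pos : Fin n → Fin (3 ℕ.+ k) × Fin m)
  (pos-injective : ∀ {i i′} → pos i ≡ pos i′ → i ≡ i′)
  (row-occurs : ∀ j → ∃[ i ] proj₁ (pos i) ≡ j)
  (missing : ∀ p → ∃[ l ] ∀ i → pos i ≢ (p ↑ˡ k , l)) where

  open Extension E
  open OrderedBasis Γ using (γ)
  open Coordinates Γ
  open MonomialCode Γ pos pos-injective row-occurs
  private
    module F where
      open Field F public
      open FieldProperties F public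
    module K where
      open Field K public
      open FieldProperties K public
  open ≡-Reasoning

  pad : Space K 3 → Space K (3 ℕ.+ k)
  pad d = d ++ λ _ → K.0#

  pad-additive : ∀ j → Additive K K (λ d → pad d j)
  pad-additive j x≡y+z with splitAt 3 j
  ... | inj₁ i = x≡y+z i
  ... | inj₂ _ = sym (K.+-identityˡ K.0#)

  dot-pad-additive : ∀ y → Additive K K (λ d → dot y (pad d))
  dot-pad-additive y = additive-sum K K λ j → additive-* K K {b = y j} (pad-additive j)

  -- A vector of y^⊥ ∩ y′^⊥ supported on the first three rows exists since 3 > 2; it can be scaled
  -- so that one entry is a basis element γ l that the columns miss.
  escape-missing : ∀ y y′ → Escape y y′
  escape-missing y y′
    with d , p , dₚ≢0 , d-ker ← nontrivial-kernel K K hK hK (ℕₚ.^-monoʳ-< r (1<order {F = K} hK) (ℕₚ.n<1+n 2))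
           (λ d → dot y (pad d) ∷ dot y′ (pad d) ∷ [])
           (λ { 0F → dot-pad-additive y ; 1F → dot-pad-additive y′ })
    with dₚ⁻¹ , dₚ⁻¹dₚ≡1 ← K.inverse (d p) dₚ≢0
    with l , l-missing ← missing p
    = z , orthogonal-z y (d-ker 0F) , orthogonal-z y′ (d-ker 1F) , escapes
    where
    z : Space K (3 ℕ.+ k)
    z j = γ l K.* dₚ⁻¹ K.* pad d j

    orthogonal-z : ∀ y → dot y (pad d) ≡ K.0# → dot y z ≡ K.0#
    orthogonal-z y yd≡0 = trans (dot-scale y (γ l K.* dₚ⁻¹) (pad d))
      (trans (cong (γ l K.* dₚ⁻¹ K.*_) yd≡0) (K.zeroʳ _))

    z-entry : z (p ↑ˡ k) ≡ γ l
    z-entry = begin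
      γ l K.* dₚ⁻¹ K.* pad d (p ↑ˡ k)   ≡⟨ cong (γ l K.* dₚ⁻¹ K.*_) (lookup-++ˡ d (λ _ → K.0#) p) ⟩
      γ l K.* dₚ⁻¹ K.* d p              ≡⟨ K.*-assoc (γ l) dₚ⁻¹ (d p) ⟩
      γ l K.* (dₚ⁻¹ K.* d p)            ≡⟨ cong (γ l K.*_) dₚ⁻¹dₚ≡1 ⟩
      γ l K.* K.1#                      ≡⟨ K.*-identityʳ (γ l) ⟩
      γ l                               ∎

    -- In row `p`, coordinate `l` of the sum is t: `z` has entry γ_l there, and the columns
    -- contribute nothing at a missing pair.
    escapes : ∀ t a → (∀ j → embed t K.* z j K.+ columns a j ≡ K.0#) → t ≡ F.0#
    escapes t a x≡0 = begin
      t
        ≡⟨ trans (cong (t F.*_) (coord-γ-≡ l)) (F.*-identityʳ t) ⟨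
      t F.* coord l (γ l)
        ≡⟨ coord-* l t (γ l) ⟨
      coord l (embed t K.* γ l)
        ≡⟨ F.+-identityʳ _ ⟨
      coord l (embed t K.* γ l) F.+ F.0#
        ≡⟨ cong₂ F._+_ (cong (λ e → coord l (embed t K.* e)) z-entry) (columns-missing l-missing a) ⟨
      coord l (embed t K.* z (p ↑ˡ k)) F.+ coord l (columns a (p ↑ˡ k))
        ≡⟨ coord-+ l _ _ ⟨
      coord l (embed t K.* z (p ↑ˡ k) K.+ columns a (p ↑ˡ k))
        ≡⟨ cong (coord l) (x≡0 (p ↑ˡ k)) ⟩
      coord l K.0#
        ≡⟨ coord-0 l ⟩
      F.0# ∎

-- Arrangement of the columns.

-- Of the (3 + k)(3 + s) pairs, the positions (0 , 0), (1 , 0) and (2 , l) with l ≥ 2 are left out.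
module Placement (k s : ℕ) where

  -- The source is a full grid with one row fewer. Its first two rows each give one cell to the new
  -- row 2, and the later rows shift by one.
  place : Fin (2 ℕ.+ k) × Fin (3 ℕ.+ s) → Fin (3 ℕ.+ k) × Fin (3 ℕ.+ s)
  place (0F          , 0F)    = 2F , 0F
  place (0F          , suc l) = 0F , suc l
  place (1F          , 0F)    = 2F , 1F
  place (1F          , suc l) = 1F , suc l
  place (suc (suc j) , l)     = suc (suc (suc j)) , l

  -- A left inverse of `place`, which yields injectivity; its values on the omitted pairs are
  -- arbitrary.
  unplace : Fin (3 ℕ.+ k) × Fin (3 ℕ.+ s) → Fin (2 ℕ.+ k) × Fin (3 ℕ.+ s)
  unplace (0F                , l)     = 0F , l
  unplace (1F                , l)     = 1F , l
  unplace (2F                , 0F)    = 0F , 0F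
  unplace (2F                , suc _) = 1F , 0F
  unplace (suc (suc (suc j)) , l)     = suc (suc j) , l

  unplace-place : ∀ e → unplace (place e) ≡ e
  unplace-place (0F          , 0F)    = refl
  unplace-place (0F          , suc l) = refl
  unplace-place (1F          , 0F)    = refl
  unplace-place (1F          , suc l) = refl
  unplace-place (suc (suc j) , l)     = refl

  place-row : ∀ j → ∃[ e ] proj₁ (place e) ≡ j
  place-row 0F                  = (0F , 1F) , refl
  place-row 1F                  = (1F , 1F) , refl
  place-row 2F                  = (0F , 0F) , refl
  place-row (suc (suc (suc j))) = (suc (suc j) , 0F) , refl

  place-missing : ∀ p → ∃[ l ] ∀ e → place e ≢ (p ↑ˡ k , l)
  place-missing 0F = 0F , λ
    { (0F , 0F) () ; (0F , suc _) () ; (1F , 0F) () ; (1F , suc _) () ; (suc (suc _) , _) () }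
  place-missing 1F = 0F , λ
    { (0F , 0F) () ; (0F , suc _) () ; (1F , 0F) () ; (1F , suc _) () ; (suc (suc _) , _) () }
  -- Row 2 receives only the positions 0 and 1; position 2 exists because m = 3 + s.
  place-missing 2F = 2F , λ
    { (0F , 0F) () ; (0F , suc _) () ; (1F , 0F) () ; (1F , suc _) () ; (suc (suc _) , _) () }

  size : ℕ
  size = (2 ℕ.+ k) ℕ.* (3 ℕ.+ s)

  pos : Fin size → Fin (3 ℕ.+ k) × Fin (3 ℕ.+ s)
  pos i = place (remQuot (3 ℕ.+ s) i)

  pos-injective : ∀ {i i′} → pos i ≡ pos i′ → i ≡ i′
  pos-injective {i} {i′} eq = begin
    i                                            ≡⟨ recover i ⟨
    uncurry Fin.combine (unplace (pos i))        ≡⟨ cong (uncurry Fin.combine ∘ unplace) eq ⟩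
    uncurry Fin.combine (unplace (pos i′))       ≡⟨ recover i′ ⟩
    i′                                           ∎
    where
    open ≡-Reasoning
    recover : ∀ i → uncurry Fin.combine (unplace (pos i)) ≡ i
    recover i = trans (cong (uncurry Fin.combine) (unplace-place (remQuot (3 ℕ.+ s) i)))
      (combine-remQuot {2 ℕ.+ k} (3 ℕ.+ s) i)

  row-occurs : ∀ j → ∃[ i ] proj₁ (pos i) ≡ j
  row-occurs j with e , eq ← place-row j =
    uncurry Fin.combine e , trans (cong (proj₁ ∘ place) (uncurry remQuot-combine e)) eq

  missing : ∀ p → ∃[ l ] ∀ i → pos i ≢ (p ↑ˡ k , l)
  missing p with l , avoids ← place-missing p = l , λ i → avoids (remQuot (3 ℕ.+ s) i)

-- The equivalence.

open import Data.Nat.Base using (_*_)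

corollary6p20 : (q m k : ℕ) → IsPrimePower q → 1 ≤ m → 3 ≤ k →
    (F K : Field) → HasOrder F q → HasOrder K (q ^ m) →
    (E : Extension F K) (Γ : OrderedBasis E m) →
    (∃ λ (C : RankMetric.Code Γ ((k ∸ 1) * m) k) →
    RankMetric.Nondegenerate Γ C × RankMetric.Minimal Γ C)
    ⇔ 3 ≤ m
corollary6p20 q m (suc (suc (suc k))) _ 1≤m _ F K hF hK E Γ = mk⇔ (necessary m 1≤m hK Γ) (sufficient m hK Γ)
  where
  HasMinimalCode : ∀ m → OrderedBasis E m → Set₁
  HasMinimalCode m Γ = ∃ λ (C : RankMetric.Code Γ ((2 ℕ.+ k) * m) (3 ℕ.+ k)) →
    RankMetric.Nondegenerate Γ C × RankMetric.Minimal Γ C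

  necessary : ∀ m → 1 ≤ m → HasOrder K (q ^ m) → (Γ : OrderedBasis E m) → HasMinimalCode m Γ → 3 ≤ m
  -- The length 2 + k is one less than the dimension 3 + k.
  necessary 1 _ hK Γ (C , _) = contradiction
    (subst (3 ℕ.+ k ≤_) (ℕₚ.*-identityʳ (2 ℕ.+ k)) (dimension≤length K hK (RankMetric.Code.dimension C)))
    (ℕₚ.<⇒≱ (ℕₚ.n<1+n (2 ℕ.+ k)))
  -- Here r = q², and the exponents to compare are 2(2 + k) + 1 and 2(3 + k), which differ by
  -- exactly one.
  necessary 2 _ hK Γ (C , _ , minimal) = contradiction (λ {v} {v′} → minimal {v} {v′})
    (quadratic-not-minimal Γ hF hK
      (subst (q ^ suc ((2 ℕ.+ k) * 2) <_)
        (trans (cong (q ^_) (ℕₚ.*-comm (3 ℕ.+ k) 2)) (sym (ℕₚ.^-*-assoc q 2 (3 ℕ.+ k))))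
        (ℕₚ.^-monoʳ-< q (1<order {F = F} hF) (ℕₚ.n<1+n (suc ((2 ℕ.+ k) * 2))))) C)
  necessary (suc (suc (suc m))) _ _ _ _ = s≤s (s≤s (s≤s z≤n))

  sufficient : ∀ m → HasOrder K (q ^ m) → (Γ : OrderedBasis E m) → 3 ≤ m → HasMinimalCode m Γ
  sufficient (suc (suc (suc s))) hK Γ _ = code , nondegenerate ,
    minimal hF hK bound (escape-missing Γ hK pos pos-injective row-occurs missing)
    where
    open Placement k s
    open MonomialCode Γ pos pos-injective row-occurs
    -- The columns alone would only give equality of the two cardinalities; the extra exponent comes
    -- from the escaping vector.
    bound : (q ^ (3 ℕ.+ s)) ^ (2 ℕ.+ k) < q ^ suc size
    bound = subst (_< q ^ suc size)
      (trans (cong (q ^_) (ℕₚ.*-comm (2 ℕ.+ k) (3 ℕ.+ s))) (sym (ℕₚ.^-*-assoc q (3 ℕ.+ s) (2 ℕ.+ k))))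
      (ℕₚ.^-monoʳ-< q (1<order {F = F} hF) (ℕₚ.n<1+n size))
  sufficient (suc zero) _ _ (s≤s ())
  sufficient (suc (suc zero)) _ _ (s≤s (s≤s ()))
corollary6p20 q m (suc zero) _ _ (s≤s ())
corollary6p20 q m (suc (suc zero)) _ _ (s≤s (s≤s ()))
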